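{- Learning an unknown LPTS is decidable in the active learning framework when the teacher satisfies the friendly-teacher condition: there is a learner such that, for every target LPTS $U$ and every teacher for $U$ satisfying the friendly-teacher condition, after finitely many rounds the learner conjectures a hypothesis $H$ with $H\simeq U$.
   Context: All probabilities are rationals. $\mathrm{Dist}(S)$: discrete distributions on $S$, $\mathrm{supp}(\mu)=\{s\mid\mu(s)>0\}$. An LPTS is $\langle S,s^0,\alpha,\tau\rangle$, finite $S$, start state $s^0$, finite actions $\alpha$, finite $\tau\subseteq S\times\alpha\times\mathrm{Dist}(S)$; $s\xrightarrow{a}\mu$ means $(s,a,\mu)\in\tau$. A tree is an LPTS whose start state (root) is in the support of no transition distribution and each other state is in the support of exactly one. $\mu_1\sqsubseteq_R\mu_2$ iff there is a weight function $w:S_1\times S_2\to\mathbb{Q}\cap[0,1]$ with row sums $\mu_1$, column sums $\mu_2$ and $w(s_1,s_2)>0\Rightarrow s_1Rs_2$; $R$ is a strong simulation iff $s_1Rs_2$, $s_1\xrightarrow{a}\mu_1$ imply some $s_2\xrightarrow{a}\mu_2$ with $\mu_1\sqsubseteq_R\mu_2$; $L_1\preceq L_2$ iff a strong simulation relates the start states; $L_1\simeq L_2$ iff $L_1\preceq L_2$ and $L_2\preceq L_1$. Active learning framework: unknown target LPTS $U$; in each round the learner conjectures a hypothesis LPTS $H$, which must be consistent with the counterexamples received so far (simulate every positive one, no negative one); the teacher either confirms $H\simeq U$ (ending the interaction) or returns a tree counterexample $C$, negative if $C\preceq H$ and $C\not\preceq U$, positive if $C\preceq U$ and $C\not\preceq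 H$. An execution mapping from a tree $C$ to an LPTS $L$ is a total map $M:S_C\to S_L$ with $M(s^0_C)=s^0_L$ such that for every transition $c\xrightarrow{a}\mu_c$ of $C$ there is a transition $M(c)\xrightarrow{a}\mu_L$ of $L$ with $M$ injective on $\mathrm{supp}(\mu_c)$ and $\mu_c(c')=\mu_L(M(c'))$ for all $c'\in\mathrm{supp}(\mu_c)$. Friendly-teacher condition: every positive counterexample has an execution mapping to $U$, and every negative counterexample has an execution mapping to the hypothesis $H$ it refutes. -}

module Defs where

open import Level using (Level; 0ℓ)
open import Data.Nat using (ℕ; zero; suc)
open import Data.Fin using (Fin) renaming (zero to fzero; suc to fsuc)
open import Data.Bool using (Bool; true; false; if_then_else_)
open import Data.Vec using (Vec; lookup; foldr)
open import Data.List using (List; []; _∷_)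
open import Data.List.Membership.Propositional using (_∈_)
open import Data.List.Relation.Unary.All using (All)
open import Data.Product using (Σ; ∃; ∃-syntax; _×_; _,_; proj₁; proj₂)
open import Data.Rational using (ℚ; 0ℚ; 1ℚ; _+_; _≤_; _<_)
open import Relation.Binary.PropositionalEquality using (_≡_; _≢_)
open import Relation.Nullary using (¬_)

sumF : ∀ {n} → (Fin n → ℚ) → ℚ
sumF {zero}  f = 0ℚ
sumF {suc n} f = f fzero + sumF (λ i → f (fsuc i))

Dist : ℕ → Set
Dist n = Vec ℚ n

IsDist : ∀ {n} → Dist n → Set
IsDist {n} μ = (∀ i → 0ℚ ≤ lookup μ i) × sumF (lookup μ) ≡ 1ℚ

InSupp : ∀ {n} → Fin n → Dist n → Set
InSupp s μ = 0ℚ < lookup μ s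

Trans : ℕ → ℕ → Set
Trans k n = Fin n × Fin k × Dist n

record LPTS (k : ℕ) : Set where
  field
    n      : ℕ
    start  : Fin n
    trans  : List (Trans k n)
    wf     : ∀ {s a μ} → (s , a , μ) ∈ trans → IsDist μ
open LPTS public

IsTree : ∀ {k} → LPTS k → Set
IsTree L =
  (∀ {s a μ} → (s , a , μ) ∈ trans L → ¬ InSupp (start L) μ) ×
  (∀ s → s ≢ start L →
     Σ (Trans _ (n L)) λ t → t ∈ trans L × InSupp s (proj₂ (proj₂ t)) ×
       (∀ t′ → t′ ∈ trans L → InSupp s (proj₂ (proj₂ t′)) → t′ ≡ t))

Tree : ℕ → Set
Tree k = Σ (LPTS k) IsTree

_⊑⟨_⟩_ : ∀ {n₁ n₂} → Dist n₁ → (Fin n₁ → Fin n₂ → Set) → Dist n₂ → Set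
_⊑⟨_⟩_ {n₁} {n₂} μ₁ R μ₂ =
  Σ (Fin n₁ → Fin n₂ → ℚ) λ w →
    (∀ s₁ s₂ → 0ℚ ≤ w s₁ s₂ × w s₁ s₂ ≤ 1ℚ) ×
    (∀ s₁ → sumF (λ s₂ → w s₁ s₂) ≡ lookup μ₁ s₁) ×
    (∀ s₂ → sumF (λ s₁ → w s₁ s₂) ≡ lookup μ₂ s₂) ×
    (∀ s₁ s₂ → 0ℚ < w s₁ s₂ → R s₁ s₂)

IsStrongSim : ∀ {k} (L₁ L₂ : LPTS k) → (Fin (n L₁) → Fin (n L₂) → Set) → Set
IsStrongSim L₁ L₂ R =
  ∀ s₁ s₂ → R s₁ s₂ → ∀ a μ₁ → (s₁ , a , μ₁) ∈ trans L₁ →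
    Σ (Dist (n L₂)) λ μ₂ → (s₂ , a , μ₂) ∈ trans L₂ × μ₁ ⊑⟨ R ⟩ μ₂

_⪯_ : ∀ {k} → LPTS k → LPTS k → Set₁
L₁ ⪯ L₂ = Σ (Fin (n L₁) → Fin (n L₂) → Set) λ R →
  IsStrongSim L₁ L₂ R × R (start L₁) (start L₂)

_≃_ : ∀ {k} → LPTS k → LPTS k → Set₁
L₁ ≃ L₂ = L₁ ⪯ L₂ × L₂ ⪯ L₁

ExecMap : ∀ {k} → Tree k → LPTS k → Set
ExecMap (C , _) L =
  Σ (Fin (n C) → Fin (n L)) λ M →
    M (start C) ≡ start L ×
    (∀ c a μc → (c , a , μc) ∈ trans C →
       Σ (Dist (n L)) λ μL → (M c , a , μL) ∈ trans L ×
         (∀ c₁ c₂ → InSupp c₁ μc → InSupp c₂ μc → M c₁ ≡ M c₂ → c₁ ≡ c₂) ×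
         (∀ c′ → InSupp c′ μc → lookup μc c′ ≡ lookup μL (M c′)))

data Polarity : Set where
  positive negative : Polarity

data Response (k : ℕ) : Set where
  equivalent     : Response k
  counterexample : Tree k → Polarity → Response k

-- counterexamples received so far (most recent first)
Counterexamples : ℕ → Set
Counterexamples k = List (Tree k × Polarity)

-- transcript of the interaction: rounds (hypothesis, answer), most recent first
Transcript : ℕ → Set
Transcript k = List (LPTS k × Response k)

Learner : ℕ → Set
Learner k = Counterexamples k → LPTS k

Teacher : ℕ → Set
Teacher k = Transcript k → LPTS k → Response k

finished : ∀ {k} → Transcript k → Bool
finished []                       = false
finished ((_ , equivalent) ∷ _)   = true
finished ((_ , counterexample _ _) ∷ _) = false

cexsOf : ∀ {k} → Transcript k → Counterexamples k
cexsOf []                               = []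
cexsOf ((_ , equivalent) ∷ t)           = cexsOf t
cexsOf ((_ , counterexample C p) ∷ t)   = (C , p) ∷ cexsOf t

transcript : ∀ {k} → Learner k → Teacher k → ℕ → Transcript k
transcript L T zero    = []
transcript L T (suc m) with transcript L T m
... | t = if finished t then t
          else (L (cexsOf t) , T t (L (cexsOf t))) ∷ t

Consistent : ∀ {k} → LPTS k → Counterexamples k → Set₁
Consistent H cs = All ok cs
  where
    ok : _ → Set₁
    ok ((C , _) , positive) = C ⪯ H
    ok ((C , _) , negative) = ¬ (C ⪯ H)

FriendlyAnswer : ∀ {k} → LPTS k → LPTS k → Response k → Set₁
FriendlyAnswer U H equivalent = H ≃ U
FriendlyAnswer U H (counterexample C positive) =
  (proj₁ C ⪯ U) × ¬ (proj₁ C ⪯ H) × Lift (Level.suc 0ℓ) (ExecMap C U)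
  where open Level using (Lift)
FriendlyAnswer U H (counterexample C negative) =
  (proj₁ C ⪯ H) × ¬ (proj₁ C ⪯ U) × Lift (Level.suc 0ℓ) (ExecMap C H)
  where open Level using (Lift)

nextHyp : ∀ {k} → Learner k → Transcript k → LPTS k
nextHyp L t = L (cexsOf t)

FriendlyTeacher : ∀ {k} → LPTS k → Learner k → Teacher k → Set₁
FriendlyTeacher U L T =
  ∀ m → finished (transcript L T m) ≡ false →
    FriendlyAnswer U (nextHyp L (transcript L T m))
                     (T (transcript L T m) (nextHyp L (transcript L T m)))

ConsistentLearner : ∀ {k} → Learner k → Teacher k → Set₁
ConsistentLearner L T =
  ∀ m → finished (transcript L T m) ≡ false →
    Consistent (nextHyp L (transcript L T m)) (cexsOf (transcript L T m))

LearnsInFinitelyManyRounds : ∀ {k} → LPTS k → Learner k → Teacher k → Set₁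
LearnsInFinitelyManyRounds U L T =
  ∃[ m ] Σ (LPTS _) λ H → ∃[ rest ]
    transcript L T m ≡ (H , equivalent) ∷ rest × H ≃ U

{-# OPTIONS --safe #-}
module Submission where

-- Identification by enumeration: the LPTSs with rational probabilities are countable, and in every round
-- the learner conjectures the first one, among those enumerated so far, that agrees with all the
-- counterexamples received.  If there is none it conjectures the join of the positive counterexamples,
-- which is always consistent: being the least LPTS above them it is simulated by U, so by transitivity
-- it simulates no negative counterexample.  Once the enumeration has reached U, each further round
-- discards a candidate preceding U.
-- Consistency is decidable because ⊑ is a linear feasibility problem over ℚ, settled by
-- Fourier–Motzkin elimination, and there are finitely many relations between two finite state sets.

open import Defs
open import Algebra.Bundles using (CommutativeMonoid)
open import Data.Bool using (T; T?; false; if_then_else_)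
open import Data.Fin using (Fin; zero; suc; _≟_; _↑ˡ_; _↑ʳ_; splitAt; combine; remQuot)
open import Data.Fin.Properties using (all?; sequence; splitAt-↑ˡ; splitAt-↑ʳ; remQuot-combine)
open import Data.Fin.Subset using (Subset)
open import Data.Fin.Subset.Properties using (anySubset?)
import Data.Integer as ℤ
open import Data.List using (List; []; _∷_; _++_; _∷ʳ_; length; map; concatMap; filter; allFin; cartesianProductWith)
open import Data.List.Membership.Propositional using (_∈_; find; lose)
open import Data.List.Membership.Propositional.Properties
  using (∈-map⁺; ∈-map⁻; ∈-++⁺ˡ; ∈-++⁺ʳ; ∈-++⁻; ∈-filter⁺; ∈-filter⁻; ∈-concatMap⁺; ∈-allFin;
         ∈-cartesianProductWith⁺; ∈-cartesianProductWith⁻)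
open import Data.List.Properties using (++-assoc; ++-identityʳ; ∷ʳ-++)
open import Data.List.Relation.Unary.All as All using (All; []; _∷_)
import Data.List.Relation.Unary.All.Properties as All
open import Data.List.Relation.Unary.Any as Any using (Any; here; there)
open import Data.Nat using (ℕ; zero; suc; _≤′_; ≤′-refl; ≤′-step)
import Data.Nat as ℕ
import Data.Nat.Properties as ℕ
open import Data.Product using (Σ; ∃; _×_; _,_; proj₁; proj₂; uncurry)
open import Data.Rational using (ℚ; 0ℚ; 1ℚ; mkℚ; _+_; _*_; _-_; -_; 1/_; _/_; _≤_; _<_)
import Data.Rational as ℚ
open import Data.Rational.Properties hiding (_≟_)
import Data.Rational.Properties as ℚ
open import Data.Rational.Solver using (module +-*-Solver)
open import Data.Sum using (_⊎_; inj₁; inj₂; [_,_]′)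
open import Data.Unit using (⊤; tt)
open import Data.Vec using (Vec; []; _∷_; lookup; tabulate; toList; fromList)
open import Data.Vec.Properties using (lookup∘tabulate; toList∘fromList)
open import Effect.Monad using (RawMonad)
open import Function using (_∘_; id; _⇔_; mk⇔; Equivalence)
open import Function.Construct.Composition using (_⇔-∘_)
open import Function.Construct.Identity using (⇔-id)
open import Function.Construct.Symmetry using (⇔-sym)
open import Relation.Binary.Bundles using (DecTotalOrder)
open import Relation.Binary.Definitions using (Decidable; tri<; tri≈; tri>)
open import Relation.Binary.PropositionalEquality
  using (_≡_; refl; sym; cong; cong₂; subst; subst₂; module ≡-Reasoning) renaming (trans to ≡-trans)
open import Relation.Nullary using (¬_; ¬?; Dec; yes; no; contradiction; ¬¬-excluded-middle)
open import Relation.Nullary.Decidable using (map′; _×-dec_; _→-dec_; isYes; toWitness; fromWitness)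
open import Relation.Nullary.Negation using (¬¬-Monad)
open import Algebra.Properties.CommutativeSemigroup (CommutativeMonoid.commutativeSemigroup +-0-commutativeMonoid)
  using () renaming (interchange to +-interchange)
open import Data.List.Extrema (DecTotalOrder.totalOrder ≤-decTotalOrder) using (max; min; xs≤max; min≤xs; max≤v⁺)
open Equivalence using (to; from)
open +-*-Solver using (solve; _:=_; _:+_; _:*_; :-_; _:-_)

-- Finite sums of rationals

sumF-cong : ∀ {n} {f g : Fin n → ℚ} → (∀ i → f i ≡ g i) → sumF f ≡ sumF g
sumF-cong {zero}  eq = refl
sumF-cong {suc n} eq = cong₂ _+_ (eq zero) (sumF-cong (eq ∘ suc))

sumF-0 : ∀ n → sumF {n} (λ _ → 0ℚ) ≡ 0ℚ
sumF-0 zero    = refl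
sumF-0 (suc n) = ≡-trans (+-identityˡ _) (sumF-0 n)

sumF-+ : ∀ {n} (f g : Fin n → ℚ) → sumF (λ i → f i + g i) ≡ sumF f + sumF g
sumF-+ {zero}  f g = refl
sumF-+ {suc n} f g = ≡-trans (cong (f zero + g zero +_) (sumF-+ (f ∘ suc) (g ∘ suc)))
  (+-interchange (f zero) (g zero) (sumF (f ∘ suc)) (sumF (g ∘ suc)))

sumF-*ˡ : ∀ {n} c (f : Fin n → ℚ) → sumF (λ i → c * f i) ≡ c * sumF f
sumF-*ˡ {zero}  c f = sym (*-zeroʳ c)
sumF-*ˡ {suc n} c f = ≡-trans (cong (c * f zero +_) (sumF-*ˡ c (f ∘ suc))) (sym (*-distribˡ-+ c _ _))

sumF-*ʳ : ∀ {n} c (f : Fin n → ℚ) → sumF (λ i → f i * c) ≡ sumF f * c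
sumF-*ʳ c f = ≡-trans (sumF-cong (λ i → *-comm (f i) c)) (≡-trans (sumF-*ˡ c f) (*-comm c _))

sumF-swap : ∀ {m n} (f : Fin m → Fin n → ℚ) →
            sumF (λ i → sumF (f i)) ≡ sumF (λ j → sumF (λ i → f i j))
sumF-swap {zero} {n} f = sym (sumF-0 n)
sumF-swap {suc m}    f = ≡-trans (cong (sumF (f zero) +_) (sumF-swap (f ∘ suc)))
  (sym (sumF-+ (f zero) (λ j → sumF (λ i → f (suc i) j))))

sumF-≥0 : ∀ {n} {f : Fin n → ℚ} → (∀ i → 0ℚ ≤ f i) → 0ℚ ≤ sumF f
sumF-≥0 {zero}  f≥0 = ≤-refl
sumF-≥0 {suc n} f≥0 = +-mono-≤ (f≥0 zero) (sumF-≥0 (f≥0 ∘ suc))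

term≤sumF : ∀ {n} {f : Fin n → ℚ} → (∀ i → 0ℚ ≤ f i) → ∀ i → f i ≤ sumF f
term≤sumF {f = f} f≥0 zero =
  subst (_≤ sumF f) (+-identityʳ _) (+-monoʳ-≤ (f zero) (sumF-≥0 (f≥0 ∘ suc)))
term≤sumF {f = f} f≥0 (suc i) =
  subst (_≤ sumF f) (+-identityˡ _) (+-mono-≤ (f≥0 zero) (term≤sumF (f≥0 ∘ suc) i))

sumF>0⇒term>0 : ∀ {n} {f : Fin n → ℚ} → 0ℚ < sumF f → ∃ λ i → 0ℚ < f i
sumF>0⇒term>0 {zero}      0<0 = contradiction 0<0 (<-irrefl refl)
sumF>0⇒term>0 {suc n} {f} 0<s with 0ℚ <? f zero
... | yes 0<f = zero , 0<f
... | no  0≮f with sumF>0⇒term>0 (<-≤-trans 0<s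
       (subst (sumF f ≤_) (+-identityˡ _) (+-mono-≤ (≮⇒≥ 0≮f) ≤-refl)))
...   | i , 0<fi = suc i , 0<fi

0≤p*q : ∀ {p q} → 0ℚ ≤ p → 0ℚ ≤ q → 0ℚ ≤ p * q
0≤p*q {p} {q} 0≤p 0≤q = subst (_≤ p * q) (*-zeroʳ p) (*-monoˡ-≤-nonNeg p 0≤q)
  where instance _ = ℚ.nonNegative 0≤p

0≤∧≮0⇒≡0 : ∀ {p} → 0ℚ ≤ p → ¬ 0ℚ < p → p ≡ 0ℚ
0≤∧≮0⇒≡0 0≤p ¬0<p = ≤-antisym (≮⇒≥ ¬0<p) 0≤p

p*q>0⇒p>0 : ∀ {p q} → 0ℚ ≤ p → 0ℚ < p * q → 0ℚ < p
p*q>0⇒p>0 {p} {q} 0≤p 0<pq with 0ℚ <? p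
... | yes 0<p = 0<p
... | no ¬0<p = contradiction 0<pq (<-irrefl (sym (≡-trans (cong (_* q) (0≤∧≮0⇒≡0 0≤p ¬0<p)) (*-zeroˡ q))))

p*q>0⇒q>0 : ∀ {p q} → 0ℚ ≤ q → 0ℚ < p * q → 0ℚ < q
p*q>0⇒q>0 {p} {q} 0≤q 0<pq = p*q>0⇒p>0 0≤q (subst (0ℚ <_) (*-comm p q) 0<pq)

pos-inverse : ∀ {p} → 0ℚ < p → ∃ λ r → 0ℚ < r × r * p ≡ 1ℚ
pos-inverse {p} 0<p = 1/ p , positive⁻¹ (1/ p) , *-inverseˡ p
  where instance _ = ℚ.positive 0<p
                 _ = pos⇒nonZero p
                 _ = 1/pos⇒pos p

-- The bound x ≤ p covers p ≡ 0, where the reciprocal is taken to be 0.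
recip : ∀ {p} → 0ℚ ≤ p → ∃ λ r → 0ℚ ≤ r × (∀ {x} → 0ℚ ≤ x → x ≤ p → x * (r * p) ≡ x)
recip {p} 0≤p with 0ℚ <? p
... | yes 0<p with pos-inverse 0<p
...   | r , 0<r , rp≡1 = r , <⇒≤ 0<r , λ {x} _ _ → ≡-trans (cong (x *_) rp≡1) (*-identityʳ x)
recip {p} 0≤p | no ¬0<p = 0ℚ , ≤-refl , λ {x} 0≤x x≤p →
  let x≡0 = ≤-antisym (≤-trans x≤p (≮⇒≥ ¬0<p)) 0≤x in
  ≡-trans (cong (_* (0ℚ * p)) x≡0) (≡-trans (*-zeroˡ (0ℚ * p)) (sym x≡0))

pick : ∀ {p} {P : Set p} → Dec P → ℚ → ℚ
pick (yes _) q = q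
pick (no  _) q = 0ℚ

pick-≥0 : ∀ {p} {P : Set p} (d : Dec P) {q} → 0ℚ ≤ q → 0ℚ ≤ pick d q
pick-≥0 (yes _) 0≤q = 0≤q
pick-≥0 (no  _) _   = ≤-refl

pick>0 : ∀ {p} {P : Set p} (d : Dec P) {q} → 0ℚ < pick d q → P × 0ℚ < q
pick>0 (yes p) 0<q = p , 0<q
pick>0 (no  _) 0<0 = contradiction 0<0 (<-irrefl refl)

sumF-pick : ∀ {n p} {P : Set p} (d : Dec P) (f : Fin n → ℚ) →
            sumF (λ i → pick d (f i)) ≡ pick d (sumF f)
sumF-pick     (yes _) f = refl
sumF-pick {n} (no _)  f = sumF-0 n

pick-suc : ∀ {n} (i j : Fin n) q → pick (suc i ≟ suc j) q ≡ pick (i ≟ j) q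
pick-suc i j q with i ≟ j
... | yes _ = refl
... | no  _ = refl

sumF-pick-≟ : ∀ {n} (i : Fin n) (f : Fin n → ℚ) → sumF (λ j → pick (i ≟ j) (f j)) ≡ f i
sumF-pick-≟ {suc n} zero f = ≡-trans (cong (f zero +_) (sumF-0 n)) (+-identityʳ _)
sumF-pick-≟ (suc i) f = ≡-trans (+-identityˡ _)
  (≡-trans (sumF-cong (λ j → pick-suc i j (f (suc j)))) (sumF-pick-≟ i (f ∘ suc)))

-- Weight functions and joins of LPTSs

-- The upper bound on the weights comes from the row sums: an entry is at most the sum of its row,
-- which is a probability.
mk⊑ : ∀ {m n} (μ : Dist m) (ν : Dist n) {R : Fin m → Fin n → Set} → IsDist μ →
      (w : Fin m → Fin n → ℚ) → (∀ s t → 0ℚ ≤ w s t) →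
      (∀ s → sumF (w s) ≡ lookup μ s) → (∀ t → sumF (λ s → w s t) ≡ lookup ν t) →
      (∀ s t → 0ℚ < w s t → R s t) → μ ⊑⟨ R ⟩ ν
mk⊑ μ ν (μ≥0 , Σμ≡1) w w≥0 rows cols supp = w , bounds , rows , cols , supp
  where
  open ≤-Reasoning
  bounds : ∀ s t → 0ℚ ≤ w s t × w s t ≤ 1ℚ
  bounds s t = w≥0 s t , (begin
    w s t            ≤⟨ term≤sumF (w≥0 s) t ⟩
    sumF (w s)       ≡⟨ rows s ⟩
    lookup μ s       ≤⟨ term≤sumF μ≥0 s ⟩
    sumF (lookup μ)  ≡⟨ Σμ≡1 ⟩
    1ℚ               ∎)

-- Gluing of couplings: given the middle state `t`, the outer states are chosen independently, so
-- the weight of `(s , u)` is the sum over `t` of `v s t * w t u / lookup μ t`. Where `lookup μ t`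
-- is zero, both `v s t` and `w t u` vanish, and the conventional value of the reciprocal does no
-- harm.
⊑-trans : ∀ {l m n} (λ′ : Dist l) (μ : Dist m) (ν : Dist n) {R S} → IsDist λ′ →
          λ′ ⊑⟨ R ⟩ μ → μ ⊑⟨ S ⟩ ν → λ′ ⊑⟨ (λ s u → ∃ λ t → R s t × S t u) ⟩ ν
⊑-trans λ′ μ ν {R} {S} dist (v , v-bd , v-rows , v-cols , v-supp) (w , w-bd , w-rows , w-cols , w-supp) =
  mk⊑ λ′ ν dist vw vw≥0 rows cols supp
  where
  open ≡-Reasoning
  v≥0 : ∀ s t → 0ℚ ≤ v s t
  v≥0 s t = proj₁ (v-bd s t)
  w≥0 : ∀ t u → 0ℚ ≤ w t u
  w≥0 t u = proj₁ (w-bd t u)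
  μ≥0 : ∀ t → 0ℚ ≤ lookup μ t
  μ≥0 t = subst (0ℚ ≤_) (v-cols t) (sumF-≥0 (λ s → v≥0 s t))
  v≤μ : ∀ s t → v s t ≤ lookup μ t
  v≤μ s t = subst (v s t ≤_) (v-cols t) (term≤sumF (λ s → v≥0 s t) s)
  w≤μ : ∀ t u → w t u ≤ lookup μ t
  w≤μ t u = subst (w t u ≤_) (w-rows t) (term≤sumF (w≥0 t) u)
  r : ∀ t → ℚ
  r t = proj₁ (recip (μ≥0 t))
  r≥0 : ∀ t → 0ℚ ≤ r t
  r≥0 t = proj₁ (proj₂ (recip (μ≥0 t)))
  r-inv : ∀ t {x} → 0ℚ ≤ x → x ≤ lookup μ t → x * (r t * lookup μ t) ≡ x
  r-inv t = proj₂ (proj₂ (recip (μ≥0 t)))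
  term : ∀ s u t → ℚ
  term s u t = v s t * (r t * w t u)
  term≥0 : ∀ s u t → 0ℚ ≤ term s u t
  term≥0 s u t = 0≤p*q (v≥0 s t) (0≤p*q (r≥0 t) (w≥0 t u))
  vw : ∀ s u → ℚ
  vw s u = sumF (term s u)
  vw≥0 : ∀ s u → 0ℚ ≤ vw s u
  vw≥0 s u = sumF-≥0 (term≥0 s u)
  rows : ∀ s → sumF (vw s) ≡ lookup λ′ s
  rows s = begin
    sumF (λ u → sumF (term s u))                     ≡⟨ sumF-swap (term s) ⟩
    sumF (λ t → sumF (λ u → v s t * (r t * w t u)))  ≡⟨ sumF-cong (λ t → sumF-*ˡ (v s t) (λ u → r t * w t u)) ⟩
    sumF (λ t → v s t * sumF (λ u → r t * w t u))    ≡⟨ sumF-cong (λ t → cong (v s t *_) (sumF-*ˡ (r t) (w t))) ⟩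
    sumF (λ t → v s t * (r t * sumF (w t)))          ≡⟨ sumF-cong (λ t → cong (λ q → v s t * (r t * q)) (w-rows t)) ⟩
    sumF (λ t → v s t * (r t * lookup μ t))          ≡⟨ sumF-cong (λ t → r-inv t (v≥0 s t) (v≤μ s t)) ⟩
    sumF (v s)                                       ≡⟨ v-rows s ⟩
    lookup λ′ s                                      ∎
  cols : ∀ u → sumF (λ s → vw s u) ≡ lookup ν u
  cols u = begin
    sumF (λ s → sumF (term s u))                     ≡⟨ sumF-swap (λ s → term s u) ⟩
    sumF (λ t → sumF (λ s → v s t * (r t * w t u)))  ≡⟨ sumF-cong (λ t → sumF-*ʳ (r t * w t u) (λ s → v s t)) ⟩
    sumF (λ t → sumF (λ s → v s t) * (r t * w t u))  ≡⟨ sumF-cong (λ t → cong (_* (r t * w t u)) (v-cols t)) ⟩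
    sumF (λ t → lookup μ t * (r t * w t u))          ≡⟨ sumF-cong (λ t → rotate (lookup μ t) (r t) (w t u)) ⟩
    sumF (λ t → w t u * (r t * lookup μ t))          ≡⟨ sumF-cong (λ t → r-inv t (w≥0 t u) (w≤μ t u)) ⟩
    sumF (λ t → w t u)                               ≡⟨ w-cols u ⟩
    lookup ν u                                       ∎
    where
    rotate : ∀ a b c → a * (b * c) ≡ c * (b * a)
    rotate a b c = ≡-trans (*-comm a (b * c)) (≡-trans (cong (_* a) (*-comm b c)) (*-assoc c b a))
  supp : ∀ s u → 0ℚ < vw s u → ∃ λ t → R s t × S t u
  supp s u 0<vw with sumF>0⇒term>0 0<vw
  ... | t , 0<term = t , v-supp s t (p*q>0⇒p>0 {q = r t * w t u} (v≥0 s t) 0<term)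
                       , w-supp t u (p*q>0⇒q>0 {r t} (w≥0 t u) (p*q>0⇒q>0 {v s t} (0≤p*q (r≥0 t) (w≥0 t u)) 0<term))

⪯-trans : ∀ {k} (L₁ L₂ L₃ : LPTS k) → L₁ ⪯ L₂ → L₂ ⪯ L₃ → L₁ ⪯ L₃
⪯-trans L₁ L₂ L₃ (R , R-sim , R₀) (S , S-sim , S₀) = _ , sim , (start L₂ , R₀ , S₀)
  where
  sim : IsStrongSim L₁ L₃ (λ s u → ∃ λ t → R s t × S t u)
  sim s u (t , Rst , Stu) a μ s→μ with R-sim s t Rst a μ s→μ
  ... | ν , t→ν , μ⊑ν with S-sim t u Stu a ν t→ν
  ...   | ξ , u→ξ , ν⊑ξ = ξ , u→ξ , ⊑-trans μ ν ξ {S = S} (wf L₁ s→μ) μ⊑ν ν⊑ξ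

-- The image measure of `μ` under `f`. Adding up each fibre of `f` avoids a partial inverse.
push : ∀ {m n} → (Fin m → Fin n) → Dist m → Dist n
push f μ = tabulate λ j → sumF λ i → pick (f i ≟ j) (lookup μ i)

lookup-push : ∀ {m n} (f : Fin m → Fin n) μ j → lookup (push f μ) j ≡ sumF λ i → pick (f i ≟ j) (lookup μ i)
lookup-push f μ j = lookup∘tabulate _ j

push-dist : ∀ {m n} (f : Fin m → Fin n) μ → IsDist μ → IsDist (push f μ)
push-dist f μ (μ≥0 , Σμ≡1) =
  (λ j → subst (0ℚ ≤_) (sym (lookup-push f μ j)) (sumF-≥0 (λ i → pick-≥0 (f i ≟ j) (μ≥0 i)))) ,
  (begin
    sumF (lookup (push f μ))                                ≡⟨ sumF-cong (lookup-push f μ) ⟩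
    sumF (λ j → sumF (λ i → pick (f i ≟ j) (lookup μ i)))   ≡⟨ sumF-swap (λ j i → pick (f i ≟ j) (lookup μ i)) ⟩
    sumF (λ i → sumF (λ j → pick (f i ≟ j) (lookup μ i)))   ≡⟨ sumF-cong (λ i → sumF-pick-≟ (f i) (λ _ → lookup μ i)) ⟩
    sumF (lookup μ)                                         ≡⟨ Σμ≡1 ⟩
    1ℚ                                                      ∎)
  where open ≡-Reasoning

-- The weight function is `μ` placed on the graph of `f`.
⊑-push : ∀ {m n} (f : Fin m → Fin n) μ {R} → IsDist μ → (∀ i → R i (f i)) → μ ⊑⟨ R ⟩ push f μ
⊑-push f μ {R} dist Rf = mk⊑ μ (push f μ) dist (λ i j → pick (f i ≟ j) (lookup μ i))
  (λ i j → pick-≥0 (f i ≟ j) (proj₁ dist i))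
  (λ i → sumF-pick-≟ (f i) (λ _ → lookup μ i))
  (λ j → sym (lookup-push f μ j))
  supp
  where
  supp : ∀ i j → 0ℚ < pick (f i ≟ j) (lookup μ i) → R i j
  supp i j 0<w with pick>0 (f i ≟ j) 0<w
  ... | refl , _ = Rf i

-- The given weights are pushed forward in their first argument. This keeps the column sums, and a
-- positive new entry has a positive old entry in its fibre, from which the new relation is
-- obtained.
push-⊑ : ∀ {l m n} (f : Fin l → Fin m) (μ : Dist l) (ν : Dist n) {R} {S : Fin m → Fin n → Set} →
         IsDist μ → (∀ i u → R i u → S (f i) u) → μ ⊑⟨ R ⟩ ν → push f μ ⊑⟨ S ⟩ ν
push-⊑ f μ ν {R} {S} dist RS (w , w-bd , w-rows , w-cols , w-supp) =
  mk⊑ (push f μ) ν (push-dist f μ dist) fw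
    (λ j u → sumF-≥0 (λ i → pick-≥0 (f i ≟ j) (proj₁ (w-bd i u)))) rows cols supp
  where
  open ≡-Reasoning
  fw : ∀ j u → ℚ
  fw j u = sumF λ i → pick (f i ≟ j) (w i u)
  rows : ∀ j → sumF (fw j) ≡ lookup (push f μ) j
  rows j = begin
    sumF (λ u → sumF (λ i → pick (f i ≟ j) (w i u)))  ≡⟨ sumF-swap (λ u i → pick (f i ≟ j) (w i u)) ⟩
    sumF (λ i → sumF (λ u → pick (f i ≟ j) (w i u)))  ≡⟨ sumF-cong (λ i → sumF-pick (f i ≟ j) (w i)) ⟩
    sumF (λ i → pick (f i ≟ j) (sumF (w i)))          ≡⟨ sumF-cong (λ i → cong (pick (f i ≟ j)) (w-rows i)) ⟩
    sumF (λ i → pick (f i ≟ j) (lookup μ i))          ≡⟨ lookup-push f μ j ⟨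
    lookup (push f μ) j                               ∎
  cols : ∀ u → sumF (λ j → fw j u) ≡ lookup ν u
  cols u = begin
    sumF (λ j → sumF (λ i → pick (f i ≟ j) (w i u)))  ≡⟨ sumF-swap (λ j i → pick (f i ≟ j) (w i u)) ⟩
    sumF (λ i → sumF (λ j → pick (f i ≟ j) (w i u)))  ≡⟨ sumF-cong (λ i → sumF-pick-≟ (f i) (λ _ → w i u)) ⟩
    sumF (λ i → w i u)                                ≡⟨ w-cols u ⟩
    lookup ν u                                        ∎
  supp : ∀ j u → 0ℚ < fw j u → S j u
  supp j u 0<fw with sumF>0⇒term>0 0<fw
  ... | i , 0<pick with pick>0 (f i ≟ j) 0<pick
  ...   | refl , 0<w = RS i u (w-supp i u 0<w)

module _ {k N : ℕ} (L : LPTS k) (ι : Fin (n L) → Fin N) (r : Fin N) where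

  relocate : (Fin (n L) → Fin N) → Trans k (n L) → Trans k N
  relocate f (s , a , μ) = f s , a , push ι μ

  -- The image of `L` under `ι`, with the initial transitions repeated from `r`, so that `r` behaves
  -- like a second start state. All target distributions are images under `ι`, hence `r` is never
  -- entered when it lies outside the image of `ι`.
  copy : List (Trans k N)
  copy = map (relocate ι) (trans L) ++
         map (relocate (λ _ → r)) (filter (λ t → proj₁ t ≟ start L) (trans L))

  copy⁺ : ∀ {s a μ} → (s , a , μ) ∈ trans L → (ι s , a , push ι μ) ∈ copy
  copy⁺ t∈ = ∈-++⁺ˡ (∈-map⁺ (relocate ι) t∈)

  copy-root⁺ : ∀ {a μ} → (start L , a , μ) ∈ trans L → (r , a , push ι μ) ∈ copy
  copy-root⁺ t∈ = ∈-++⁺ʳ (map (relocate ι) (trans L))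
    (∈-map⁺ (relocate (λ _ → r)) (∈-filter⁺ (λ t → proj₁ t ≟ start L) t∈ refl))

  copy⁻ : ∀ {j a ν} → (j , a , ν) ∈ copy → ∃ λ s → ∃ λ μ → (s , a , μ) ∈ trans L ×
          ν ≡ push ι μ × (j ≡ ι s ⊎ j ≡ r × s ≡ start L)
  copy⁻ t∈ with ∈-++⁻ (map (relocate ι) (trans L)) t∈
  ... | inj₁ t∈₁ with ∈-map⁻ (relocate ι) t∈₁
  ...   | (s , a , μ) , t∈L , refl = s , μ , t∈L , refl , inj₁ refl
  copy⁻ t∈ | inj₂ t∈₂ with ∈-map⁻ (relocate (λ _ → r)) t∈₂
  ...   | (s , a , μ) , t∈f , refl with ∈-filter⁻ (λ t → proj₁ t ≟ start L) {xs = trans L} t∈f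
  ...     | t∈L , s≡start = s , μ , t∈L , refl , inj₂ (refl , s≡start)

  copy-dist : ∀ {j a ν} → (j , a , ν) ∈ copy → IsDist ν
  copy-dist t∈ with copy⁻ t∈
  ... | s , μ , t∈L , refl , _ = push-dist ι μ (wf L t∈L)

  -- A transition of the copy stems from a transition of some `s` in `L`, and the assumptions on `S`
  -- make `u` simulate `s` under `R`, whether the copied transition leaves `ι s` or `r`. The match
  -- found there is pushed forward along `ι`.
  copy-sim : ∀ {U : LPTS k} {R : Fin (n L) → Fin (n U) → Set} {S : Fin N → Fin (n U) → Set} →
             IsStrongSim L U R → (∀ s u → R s u → S (ι s) u) → (∀ s u → S (ι s) u → R s u) →
             (∀ u → S r u → R (start L) u) →
             ∀ {j u a ν} → S j u → (j , a , ν) ∈ copy → ∃ λ ξ → (u , a , ξ) ∈ trans U × ν ⊑⟨ S ⟩ ξ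
  copy-sim {U} {R} {S} R-sim R⇒S S⇒R Sr⇒R {u = u} {a} Sju t∈ with copy⁻ t∈
  ... | s , μ , t∈L , refl , j≡ with R-sim s u (Rsu j≡ Sju) a μ t∈L
    where
    Rsu : ∀ {j} → j ≡ ι s ⊎ j ≡ r × s ≡ start L → S j u → R s u
    Rsu (inj₁ refl)          = S⇒R s u
    Rsu (inj₂ (refl , refl)) = Sr⇒R u
  ...   | ξ , u→ξ , μ⊑ξ = ξ , u→ξ , push-⊑ ι μ ξ {S = S} (wf L t∈L) R⇒S μ⊑ξ

-- Each state is simulated by its copy, and the start state also by the start state of `J`. A
-- distribution is matched by its image.
⪯-copy : ∀ {k} (L J : LPTS k) (ι : Fin (n L) → Fin (n J)) →
         (∀ {t} → t ∈ copy L ι (start J) → t ∈ trans J) → L ⪯ J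
⪯-copy L J ι copy⊆J = R , sim , inj₂ (refl , refl)
  where
  R : Fin (n L) → Fin (n J) → Set
  R s j = j ≡ ι s ⊎ j ≡ start J × s ≡ start L
  sim : IsStrongSim L J R
  sim s j (inj₁ refl) a μ t∈ = push ι μ , copy⊆J (copy⁺ L ι (start J) t∈) ,
    ⊑-push ι μ {R = R} (wf L t∈) (λ _ → inj₁ refl)
  sim s j (inj₂ (refl , refl)) a μ t∈ = push ι μ , copy⊆J (copy-root⁺ L ι (start J) t∈) ,
    ⊑-push ι μ {R = R} (wf L t∈) (λ _ → inj₁ refl)

module _ {k : ℕ} (L₁ L₂ : LPTS k) where

  private
    N : ℕ
    N = suc (n L₁ ℕ.+ n L₂)
    ι₁ : Fin (n L₁) → Fin N
    ι₁ s = suc (s ↑ˡ n L₂)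
    ι₂ : Fin (n L₂) → Fin N
    ι₂ s = suc (n L₁ ↑ʳ s)

  -- The root is fresh, since the start states may have incoming transitions.
  join : LPTS k
  join = record
    { n     = N
    ; start = zero
    ; trans = copy L₁ ι₁ zero ++ copy L₂ ι₂ zero
    ; wf    = λ t∈ → [ copy-dist L₁ ι₁ zero , copy-dist L₂ ι₂ zero ]′ (∈-++⁻ (copy L₁ ι₁ zero) t∈)
    }

  ⪯-joinˡ : L₁ ⪯ join
  ⪯-joinˡ = ⪯-copy L₁ join ι₁ ∈-++⁺ˡ

  ⪯-joinʳ : L₂ ⪯ join
  ⪯-joinʳ = ⪯-copy L₂ join ι₂ (∈-++⁺ʳ (copy L₁ ι₁ zero))

  join-lub : ∀ U → L₁ ⪯ U → L₂ ⪯ U → join ⪯ U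
  join-lub U (R₁ , R₁-sim , R₁-start) (R₂ , R₂-sim , R₂-start) =
    S , sim , (R₁-start , R₂-start)
    where
    S : Fin N → Fin (n U) → Set
    -- The root carries the initial transitions of both LPTSs, so `u` has to simulate both start
    -- states.
    S zero    u = R₁ (start L₁) u × R₂ (start L₂) u
    S (suc j) u = [ (λ s → R₁ s u) , (λ s → R₂ s u) ]′ (splitAt (n L₁) j)
    S-ι₁ : ∀ s u → S (ι₁ s) u ≡ R₁ s u
    S-ι₁ s u = cong [ (λ s → R₁ s u) , (λ s → R₂ s u) ]′ (splitAt-↑ˡ (n L₁) s (n L₂))
    S-ι₂ : ∀ s u → S (ι₂ s) u ≡ R₂ s u
    S-ι₂ s u = cong [ (λ s → R₁ s u) , (λ s → R₂ s u) ]′ (splitAt-↑ʳ (n L₁) (n L₂) s)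
    sim : IsStrongSim join U S
    sim j u Sju a ν t∈ with ∈-++⁻ (copy L₁ ι₁ zero) t∈
    ... | inj₁ t∈₁ = copy-sim L₁ ι₁ zero {U} {R₁} {S} R₁-sim (λ s u → subst id (sym (S-ι₁ s u)))
                       (λ s u → subst id (S-ι₁ s u)) (λ _ → proj₁) Sju t∈₁
    ... | inj₂ t∈₂ = copy-sim L₂ ι₂ zero {U} {R₂} {S} R₂-sim (λ s u → subst id (sym (S-ι₂ s u)))
                       (λ s u → subst id (S-ι₂ s u)) (λ _ → proj₂) Sju t∈₂

-- Fourier–Motzkin elimination

≤⇔0≤- : ∀ {p q} → p ≤ q ⇔ 0ℚ ≤ q - p
≤⇔0≤- {p} {q} = mk⇔
  (λ p≤q → subst (_≤ q - p) (+-inverseʳ p) (+-monoˡ-≤ (- p) p≤q))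
  (λ 0≤d → subst₂ _≤_ (+-identityˡ p) (solve 2 (λ p q → (q :- p) :+ p := q) refl p q) (+-monoˡ-≤ p 0≤d))

0≤⇔0≤* : ∀ {e p} → 0ℚ < e → 0ℚ ≤ p ⇔ 0ℚ ≤ e * p
0≤⇔0≤* {e} {p} 0<e = mk⇔ (0≤p*q (<⇒≤ 0<e))
  (λ 0≤ep → *-cancelˡ-≤-pos e (subst (_≤ e * p) (sym (*-zeroʳ e)) 0≤ep))
  where instance _ = ℚ.positive 0<e

≡⇒⇔ : ∀ {P Q : Set} → P ≡ Q → P ⇔ Q
≡⇒⇔ refl = ⇔-id _

Affine : ℕ → Set
Affine m = (Fin m → ℚ) × ℚ

eval : ∀ {m} → Affine m → (Fin m → ℚ) → ℚ
eval (a , b) x = sumF (λ i → a i * x i) + b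

_+ᴬ_ : ∀ {m} → Affine m → Affine m → Affine m
(a , b) +ᴬ (c , d) = (λ i → a i + c i) , b + d

_*ᴬ_ : ∀ {m} → ℚ → Affine m → Affine m
e *ᴬ (a , b) = (λ i → e * a i) , e * b

_-ᴬ_ : ∀ {m} → Affine m → Affine m → Affine m
f -ᴬ g = f +ᴬ ((- 1ℚ) *ᴬ g)

eval-+ : ∀ {m} (f g : Affine m) x → eval (f +ᴬ g) x ≡ eval f x + eval g x
eval-+ (a , b) (c , d) x = begin
  sumF (λ i → (a i + c i) * x i) + (b + d)      ≡⟨ cong (_+ (b + d)) (sumF-cong (λ i → *-distribʳ-+ (x i) (a i) (c i))) ⟩
  sumF (λ i → a i * x i + c i * x i) + (b + d)  ≡⟨ cong (_+ (b + d)) (sumF-+ ax cx) ⟩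
  (sumF ax + sumF cx) + (b + d)                 ≡⟨ +-interchange (sumF ax) (sumF cx) b d ⟩
  eval (a , b) x + eval (c , d) x               ∎
  where
  open ≡-Reasoning
  ax = λ i → a i * x i
  cx = λ i → c i * x i

eval-* : ∀ {m} e (f : Affine m) x → eval (e *ᴬ f) x ≡ e * eval f x
eval-* e (a , b) x = begin
  sumF (λ i → e * a i * x i) + e * b    ≡⟨ cong (_+ e * b) (sumF-cong (λ i → *-assoc e (a i) (x i))) ⟩
  sumF (λ i → e * (a i * x i)) + e * b  ≡⟨ cong (_+ e * b) (sumF-*ˡ e (λ i → a i * x i)) ⟩
  e * sumF (λ i → a i * x i) + e * b    ≡⟨ *-distribˡ-+ e _ b ⟨
  e * eval (a , b) x                    ∎
  where open ≡-Reasoning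

eval-- : ∀ {m} (f g : Affine m) x → eval (f -ᴬ g) x ≡ eval f x - eval g x
eval-- f g x = begin
  eval (f -ᴬ g) x                      ≡⟨ eval-+ f ((- 1ℚ) *ᴬ g) x ⟩
  eval f x + eval ((- 1ℚ) *ᴬ g) x      ≡⟨ cong (eval f x +_) (eval-* (- 1ℚ) g x) ⟩
  eval f x + (- 1ℚ) * eval g x         ≡⟨ cong (eval f x +_) (neg-distribˡ-* 1ℚ (eval g x)) ⟨
  eval f x - 1ℚ * eval g x             ≡⟨ cong (λ q → eval f x - q) (*-identityˡ (eval g x)) ⟩
  eval f x - eval g x                  ∎
  where open ≡-Reasoning

Sat : ∀ {m} → List (Affine m) → (Fin m → ℚ) → Set
Sat cs x = All (λ c → 0ℚ ≤ eval c x) cs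

-- A system solved for one variable: the bounds are affine functions of the remaining `m` variables,
-- and `free` holds the constraints in which the solved variable does not occur.
record Bounds (m : ℕ) : Set where
  field lower upper free : List (Affine m)
open Bounds

Within : ∀ {m} → Bounds m → ℚ → (Fin m → ℚ) → Set
Within B y x = All (λ l → eval l x ≤ y) (lower B) × All (λ u → y ≤ eval u x) (upper B) × Sat (free B) x

-- The first variable is isolated in every constraint by dividing by the absolute value of its coefficient.
isolate : ∀ {m} (cs : List (Affine (suc m))) → Σ (Bounds m) λ B → ∀ x → Sat cs x ⇔ Within B (x zero) (x ∘ suc)
isolate [] = record { lower = [] ; upper = [] ; free = [] } , λ x → mk⇔ (λ _ → [] , [] , []) (λ _ → [])
isolate ((a , b) ∷ cs) with isolate cs | <-cmp 0ℚ (a zero)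
... | B , B⇔ | tri< 0<a₀ _ _ =
  record B { lower = l ∷ lower B } , λ x → mk⇔
    (λ { (p ∷ ps) → let ls , us , fs = to (B⇔ x) ps in to (l⇔ x) p ∷ ls , us , fs })
    (λ { (l ∷ ls , us , fs) → from (l⇔ x) l ∷ from (B⇔ x) (ls , us , fs) })
  where
  e = proj₁ (pos-inverse 0<a₀)
  r = a ∘ suc , b
  l = (- e) *ᴬ r
  l⇔ : ∀ x → 0ℚ ≤ eval (a , b) x ⇔ eval l (x ∘ suc) ≤ x zero
  l⇔ x = (⇔-sym ≤⇔0≤- ⇔-∘ ≡⇒⇔ (cong (0ℚ ≤_) eq)) ⇔-∘ 0≤⇔0≤* (proj₁ (proj₂ (pos-inverse 0<a₀)))
    where
    open ≡-Reasoning
    S = sumF (λ i → a (suc i) * x (suc i))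
    eq : e * eval (a , b) x ≡ x zero - eval l (x ∘ suc)
    eq = begin
      e * ((a zero * x zero + S) + b)          ≡⟨ solve 5 (λ e a x s b → e :* ((a :* x :+ s) :+ b) :=
                                                    (e :* a) :* x :- (:- e) :* (s :+ b)) refl e (a zero) (x zero) S b ⟩
      (e * a zero) * x zero - (- e) * (S + b)  ≡⟨ cong₂ (λ p q → p * x zero - q) (proj₂ (proj₂ (pos-inverse 0<a₀)))
                                                    (sym (eval-* (- e) r (x ∘ suc))) ⟩
      1ℚ * x zero - eval l (x ∘ suc)           ≡⟨ cong (_- eval l (x ∘ suc)) (*-identityˡ (x zero)) ⟩
      x zero - eval l (x ∘ suc)                ∎
... | B , B⇔ | tri≈ _ 0≡a₀ _ =
  record B { free = (a ∘ suc , b) ∷ free B } , λ x → mk⇔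
    (λ { (p ∷ ps) → let ls , us , fs = to (B⇔ x) ps in ls , us , subst (0ℚ ≤_) (eq x) p ∷ fs })
    (λ { (ls , us , f ∷ fs) → subst (0ℚ ≤_) (sym (eq x)) f ∷ from (B⇔ x) (ls , us , fs) })
  where
  eq : ∀ x → eval (a , b) x ≡ eval (a ∘ suc , b) (x ∘ suc)
  eq x = cong (_+ b) (≡-trans
    (cong (_+ S) (≡-trans (cong (_* x zero) (sym 0≡a₀)) (*-zeroˡ (x zero)))) (+-identityˡ S))
    where S = sumF (λ i → a (suc i) * x (suc i))
... | B , B⇔ | tri> _ _ a₀<0 =
  record B { upper = u ∷ upper B } , λ x → mk⇔
    (λ { (p ∷ ps) → let ls , us , fs = to (B⇔ x) ps in ls , to (u⇔ x) p ∷ us , fs })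
    (λ { (ls , u ∷ us , fs) → from (u⇔ x) u ∷ from (B⇔ x) (ls , us , fs) })
  where
  0<-a₀ : 0ℚ < - a zero
  0<-a₀ = neg-antimono-< a₀<0
  e = proj₁ (pos-inverse 0<-a₀)
  r = a ∘ suc , b
  u = e *ᴬ r
  u⇔ : ∀ x → 0ℚ ≤ eval (a , b) x ⇔ x zero ≤ eval u (x ∘ suc)
  u⇔ x = (⇔-sym ≤⇔0≤- ⇔-∘ ≡⇒⇔ (cong (0ℚ ≤_) eq)) ⇔-∘ 0≤⇔0≤* (proj₁ (proj₂ (pos-inverse 0<-a₀)))
    where
    open ≡-Reasoning
    S = sumF (λ i → a (suc i) * x (suc i))
    eq : e * eval (a , b) x ≡ eval u (x ∘ suc) - x zero
    eq = begin
      e * ((a zero * x zero + S) + b)        ≡⟨ solve 5 (λ e a x s b → e :* ((a :* x :+ s) :+ b) :=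
                                                  e :* (s :+ b) :- (e :* (:- a)) :* x) refl e (a zero) (x zero) S b ⟩
      e * (S + b) - (e * - a zero) * x zero  ≡⟨ cong₂ (λ p q → q - p * x zero) (proj₂ (proj₂ (pos-inverse 0<-a₀)))
                                                  (sym (eval-* e r (x ∘ suc))) ⟩
      eval u (x ∘ suc) - 1ℚ * x zero         ≡⟨ cong (λ p → eval u (x ∘ suc) - p) (*-identityˡ (x zero)) ⟩
      eval u (x ∘ suc) - x zero              ∎

-- The projection of the system along the solved variable: besides the free constraints, each lower
-- bound must be at most each upper bound.
eliminate : ∀ {m} → Bounds m → List (Affine m)
eliminate B = free B ++ cartesianProductWith (λ l u → u -ᴬ l) (lower B) (upper B)

eliminate-sound : ∀ {m} (B : Bounds m) {y x} → Within B y x → Sat (eliminate B) x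
eliminate-sound B {y} {x} (ls , us , fs) = All.++⁺ fs (All.tabulate pairs)
  where
  pairs : ∀ {c} → c ∈ cartesianProductWith (λ l u → u -ᴬ l) (lower B) (upper B) → 0ℚ ≤ eval c x
  pairs c∈ with ∈-cartesianProductWith⁻ (λ l u → u -ᴬ l) (lower B) (upper B) c∈
  ... | l , u , l∈ , u∈ , refl = subst (0ℚ ≤_) (sym (eval-- u l x))
    (to ≤⇔0≤- (≤-trans (All.lookup ls l∈) (All.lookup us u∈)))

eliminate-complete : ∀ {m} (B : Bounds m) {x} → Sat (eliminate B) x → ∃ λ y → Within B y x
eliminate-complete B {x} sat = y ,
  All.map⁻ (xs≤max y₀ lows) ,
  All.tabulate (λ u∈ → max≤v⁺ (All.lookup (All.map⁻ (min≤xs 0ℚ ups)) u∈)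
    (All.map⁺ (All.tabulate λ l∈ → l≤u l∈ u∈))) ,
  All.++⁻ˡ (free B) sat
  where
  lows ups : List ℚ
  lows = map (λ l → eval l x) (lower B)
  ups  = map (λ u → eval u x) (upper B)
  y₀ y : ℚ
  -- A value below all upper bounds, the default 0 serving when there are none. Raising it just
  -- enough to meet the lower bounds keeps it below the upper bounds, and having it as a base value
  -- covers the case without lower bounds.
  y₀ = min 0ℚ ups
  y  = max y₀ lows
  l≤u : ∀ {l u} → l ∈ lower B → u ∈ upper B → eval l x ≤ eval u x
  l≤u {l} {u} l∈ u∈ = from ≤⇔0≤- (subst (0ℚ ≤_) (eval-- u l x)
    (All.lookup (All.++⁻ʳ (free B) sat) (∈-cartesianProductWith⁺ (λ l u → u -ᴬ l) l∈ u∈)))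

feasible? : ∀ {m} (cs : List (Affine m)) → Dec (∃ (Sat cs))
feasible? {zero}  cs = map′ ((λ ()) ,_) proj₂ (All.all? (λ c → 0ℚ ≤? eval c (λ ())) cs)
feasible? {suc m} cs with isolate cs
... | B , B⇔ = map′
  (λ (x , sat) → let y , within = eliminate-complete B sat in cons y x , from (B⇔ (cons y x)) within)
  (λ (x , sat) → x ∘ suc , eliminate-sound B (to (B⇔ x) sat))
  (feasible? (eliminate B))
  where
  cons : ℚ → (Fin m → ℚ) → Fin (suc m) → ℚ
  cons y x zero    = y
  cons y x (suc i) = x i

-- Affine functions and linear predicates

IsAffine : ∀ {m} → ((Fin m → ℚ) → ℚ) → Set
IsAffine f = ∃ λ c → ∀ x → eval c x ≡ f x

const-affine : ∀ {m} q → IsAffine {m} (λ _ → q)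
const-affine {m} q = ((λ _ → 0ℚ) , q) , λ x →
  ≡-trans (cong (_+ q) (≡-trans (sumF-cong (λ i → *-zeroˡ (x i))) (sumF-0 m))) (+-identityˡ q)

coordinate-affine : ∀ {m} (i : Fin m) → IsAffine (λ x → x i)
coordinate-affine i = ((λ j → pick (i ≟ j) 1ℚ) , 0ℚ) , λ x →
  ≡-trans (+-identityʳ _) (≡-trans (sumF-cong (λ j → pick-* (i ≟ j) (x j))) (sumF-pick-≟ i x))
  where
  pick-* : ∀ {P : Set} (d : Dec P) q → pick d 1ℚ * q ≡ pick d q
  pick-* (yes _) q = *-identityˡ q
  pick-* (no  _) q = *-zeroˡ q

sum-affine : ∀ {m k} {f : Fin k → (Fin m → ℚ) → ℚ} → (∀ i → IsAffine (f i)) → IsAffine (λ x → sumF (λ i → f i x))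
sum-affine {k = zero}  f-aff = const-affine 0ℚ
sum-affine {k = suc k} f-aff with f-aff zero | sum-affine (f-aff ∘ suc)
... | c , c≡ | d , d≡ = c +ᴬ d , λ x → ≡-trans (eval-+ c d x) (cong₂ _+_ (c≡ x) (d≡ x))

-- Constraint systems are handled through their solution sets, so that the closure properties below
-- assemble a system along the shape of the predicate it describes.
IsLinear : ∀ {m} → ((Fin m → ℚ) → Set) → Set
IsLinear P = ∃ λ cs → ∀ x → Sat cs x ⇔ P x

linear? : ∀ {m} {P : (Fin m → ℚ) → Set} → IsLinear P → Dec (∃ P)
linear? (cs , cs⇔) = map′ (λ (x , s) → x , to (cs⇔ x) s) (λ (x , p) → x , from (cs⇔ x) p) (feasible? cs)

⇔-linear : ∀ {m} {P Q : (Fin m → ℚ) → Set} → (∀ x → P x ⇔ Q x) → IsLinear P → IsLinear Q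
⇔-linear P⇔Q (cs , cs⇔) = cs , λ x → P⇔Q x ⇔-∘ cs⇔ x

≤-linear : ∀ {m} {f g : (Fin m → ℚ) → ℚ} → IsAffine f → IsAffine g → IsLinear (λ x → f x ≤ g x)
≤-linear (c , c≡) (d , d≡) = (d -ᴬ c) ∷ [] , λ x →
  let eq = ≡-trans (eval-- d c x) (cong₂ _-_ (d≡ x) (c≡ x)) in
  mk⇔ (λ { (p ∷ []) → from ≤⇔0≤- (subst (0ℚ ≤_) eq p) })
      (λ p → subst (0ℚ ≤_) (sym eq) (to ≤⇔0≤- p) ∷ [])

true-linear : ∀ {m} {P : (Fin m → ℚ) → Set} → (∀ x → P x) → IsLinear P
true-linear P-true = [] , λ x → mk⇔ (λ _ → P-true x) (λ _ → [])

×-linear : ∀ {m} {P Q : (Fin m → ℚ) → Set} → IsLinear P → IsLinear Q → IsLinear (λ x → P x × Q x)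
×-linear (cs , cs⇔) (ds , ds⇔) = cs ++ ds , λ x →
  mk⇔ (λ s → to (cs⇔ x) (All.++⁻ˡ cs s) , to (ds⇔ x) (All.++⁻ʳ cs s))
      (λ (p , q) → All.++⁺ (from (cs⇔ x) p) (from (ds⇔ x) q))

∀-linear : ∀ {m k} {P : Fin k → (Fin m → ℚ) → Set} → (∀ i → IsLinear (P i)) → IsLinear (λ x → ∀ i → P i x)
∀-linear {k = zero}  P-lin = true-linear (λ x ())
∀-linear {k = suc k} P-lin = ⇔-linear
  (λ x → mk⇔ (λ { (p , ps) zero → p ; (p , ps) (suc i) → ps i }) (λ ps → ps zero , ps ∘ suc))
  (×-linear (P-lin zero) (∀-linear (P-lin ∘ suc)))

≡-linear : ∀ {m} {f g : (Fin m → ℚ) → ℚ} → IsAffine f → IsAffine g → IsLinear (λ x → f x ≡ g x)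
≡-linear f-aff g-aff = ⇔-linear
  (λ x → mk⇔ (uncurry ≤-antisym) (λ eq → ≤-reflexive eq , ≤-reflexive (sym eq)))
  (×-linear (≤-linear f-aff g-aff) (≤-linear g-aff f-aff))

-- The unknowns are the `m * n` entries of the weight function, numbered by `combine`. Once `R` has
-- been decided at each pair, all conditions on them are linear.
⊑-dec : ∀ {m n} (μ : Dist m) (ν : Dist n) {R : Fin m → Fin n → Set} → Decidable R → Dec (μ ⊑⟨ R ⟩ ν)
⊑-dec {m} {n} μ ν {R} R? = map′ (λ (x , p) → (λ s t → x (combine s t)) , p) flatten
  (linear? (×-linear (∀-linear λ s → ∀-linear λ t →
                        ×-linear (≤-linear (const-affine 0ℚ) (w-aff s t)) (≤-linear (w-aff s t) (const-affine 1ℚ)))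
           (×-linear (∀-linear λ s → ≡-linear (sum-affine (w-aff s)) (const-affine (lookup μ s)))
           (×-linear (∀-linear λ t → ≡-linear (sum-affine (λ s → w-aff s t)) (const-affine (lookup ν t)))
                     (∀-linear λ s → ∀-linear λ t → supp-linear s t)))))
  where
  w-aff : ∀ s t → IsAffine (λ x → x (combine s t))
  w-aff s t = coordinate-affine (combine s t)
  supp-linear : ∀ s t → IsLinear (λ x → 0ℚ < x (combine s t) → R s t)
  -- The support condition is void at related pairs; at the others it says that the weight is at
  -- most 0, which avoids a strict inequality.
  supp-linear s t with R? s t
  ... | yes Rst = true-linear (λ _ _ → Rst)
  ... | no ¬Rst = ⇔-linear
    (λ x → mk⇔ (λ w≤0 0<w → contradiction (<-≤-trans 0<w w≤0) (<-irrefl refl)) (λ h → ≮⇒≥ (¬Rst ∘ h)))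
    (≤-linear (w-aff s t) (const-affine 0ℚ))
  Weight : (Fin m → Fin n → ℚ) → Set
  Weight w = (∀ s t → 0ℚ ≤ w s t × w s t ≤ 1ℚ) × (∀ s → sumF (w s) ≡ lookup μ s) ×
             (∀ t → sumF (λ s → w s t) ≡ lookup ν t) × (∀ s t → 0ℚ < w s t → R s t)
  flatten : μ ⊑⟨ R ⟩ ν → ∃ λ x → Weight (λ s t → x (combine s t))
  flatten (w , bounds , rows , cols , supp) = x ,
    (λ s t → subst (λ q → 0ℚ ≤ q × q ≤ 1ℚ) (sym (x≡w s t)) (bounds s t)) ,
    (λ s → ≡-trans (sumF-cong (x≡w s)) (rows s)) ,
    (λ t → ≡-trans (sumF-cong (λ s → x≡w s t)) (cols t)) ,
    (λ s t 0<x → supp s t (subst (0ℚ <_) (x≡w s t) 0<x))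
    where
    x : Fin (m ℕ.* n) → ℚ
    x q = uncurry w (remQuot n q)
    x≡w : ∀ s t → x (combine s t) ≡ w s t
    x≡w s t = cong (uncurry w) (remQuot-combine s t)

-- Decidability of simulation

⊑-mono : ∀ {m n} (μ : Dist m) (ν : Dist n) {R S : Fin m → Fin n → Set} →
         (∀ s t → R s t → S s t) → μ ⊑⟨ R ⟩ ν → μ ⊑⟨ S ⟩ ν
⊑-mono μ ν R⇒S (w , bounds , rows , cols , supp) = w , bounds , rows , cols , λ s t → R⇒S s t ∘ supp s t

module _ {k : ℕ} (L₁ L₂ : LPTS k) where

  -- The quantifiers over distributions range over an infinite type. They are replaced by searches
  -- through the two finite transition lists.
  isStrongSim? : ∀ {R : Fin (n L₁) → Fin (n L₂) → Set} → Decidable R → Dec (IsStrongSim L₁ L₂ R)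
  isStrongSim? {R} R? = map′ fwd bwd (All.all? matched? (trans L₁))
    where
    Matches : Trans k (n L₁) → Fin (n L₂) → Trans k (n L₂) → Set
    Matches (_ , a , μ) s₂ (t , b , ν) = s₂ ≡ t × a ≡ b × μ ⊑⟨ R ⟩ ν
    Matched : Trans k (n L₁) → Set
    Matched t = ∀ s₂ → R (proj₁ t) s₂ → Any (Matches t s₂) (trans L₂)
    matched? : ∀ t → Dec (Matched t)
    matched? (s , a , μ) = all? λ s₂ → R? s s₂ →-dec
      Any.any? (λ (t , b , ν) → s₂ ≟ t ×-dec (a ≟ b ×-dec ⊑-dec μ ν R?)) (trans L₂)
    fwd : All Matched (trans L₁) → IsStrongSim L₁ L₂ R
    fwd m s₁ s₂ Rs a μ t∈ with find (All.lookup m t∈ s₂ Rs)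
    ... | (_ , _ , ν) , u∈ , refl , refl , μ⊑ν = ν , u∈ , μ⊑ν
    bwd : IsStrongSim L₁ L₂ R → All Matched (trans L₁)
    bwd sim = All.tabulate λ { {s , a , μ} t∈ s₂ Rs →
      let ν , u∈ , μ⊑ν = sim s s₂ Rs a μ t∈ in lose u∈ (refl , refl , μ⊑ν) }

  private
    Rel : Subset (n L₁ ℕ.* n L₂) → Fin (n L₁) → Fin (n L₂) → Set
    Rel p s t = T (lookup p (combine s t))

    BoolSim : Subset (n L₁ ℕ.* n L₂) → Set
    BoolSim p = IsStrongSim L₁ L₂ (Rel p) × Rel p (start L₁) (start L₂)

    -- Tabulating the decisions turns `R` into a bit vector, an element of a finite search space. It
    -- denotes a relation equivalent to `R` at every pair, so matches carry over by monotonicity of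
    -- the lifting.
    decidable⇒bool : ∀ {R : Fin (n L₁) → Fin (n L₂) → Set} → Decidable R →
                     IsStrongSim L₁ L₂ R → R (start L₁) (start L₂) → ∃ BoolSim
    decidable⇒bool {R} R? sim Rstart = p , sim′ , R⇒p _ _ Rstart
      where
      p : Subset (n L₁ ℕ.* n L₂)
      p = tabulate λ q → isYes (uncurry R? (remQuot (n L₂) q))
      lookup-p : ∀ s t → lookup p (combine s t) ≡ isYes (R? s t)
      lookup-p s t = ≡-trans (lookup∘tabulate _ (combine s t))
        (cong (λ q → isYes (uncurry R? q)) (remQuot-combine s t))
      p⇒R : ∀ s t → Rel p s t → R s t
      p⇒R s t = toWitness ∘ subst T (lookup-p s t)
      R⇒p : ∀ s t → R s t → Rel p s t
      R⇒p s t = subst T (sym (lookup-p s t)) ∘ fromWitness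
      sim′ : IsStrongSim L₁ L₂ (Rel p)
      sim′ s t ps a μ t∈ with sim s t (p⇒R s t ps) a μ t∈
      ... | ν , u∈ , μ⊑ν = ν , u∈ , ⊑-mono μ ν R⇒p μ⊑ν

  -- Only decidable relations are searched; an arbitrary relation on a finite set is decidable up to ¬¬.
  ⪯-dec : Dec (L₁ ⪯ L₂)
  ⪯-dec with anySubset? (λ p → isStrongSim? (λ s t → T? (lookup p (combine s t)))
                                ×-dec T? (lookup p (combine (start L₁) (start L₂))))
  ... | yes (p , sim , st) = yes (Rel p , sim , st)
  ... | no ¬bool = no λ (R , sim , st) →
    sequence rawApplicative (λ s → sequence rawApplicative (λ t → ¬¬-excluded-middle {A = R s t}))
      (λ R? → ¬bool (decidable⇒bool R? sim st))
    where open RawMonad ¬¬-Monad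

-- Enumeration of LPTSs

upTo : ∀ {A : Set} → (ℕ → List A) → ℕ → List A
upTo e zero    = []
upTo e (suc m) = upTo e m ++ e m

-- Later stages only append. This keeps the order of earlier elements fixed, on which the notion of
-- the first consistent candidate depends.
upTo-prefix : ∀ {A : Set} (e : ℕ → List A) {l m} → l ≤′ m → ∃ λ ys → upTo e m ≡ upTo e l ++ ys
upTo-prefix e ≤′-refl = [] , sym (++-identityʳ _)
upTo-prefix e {l} (≤′-step {m} l≤m) with upTo-prefix e l≤m
... | ys , eq = ys ++ e m , ≡-trans (cong (_++ e m) eq) (++-assoc (upTo e l) ys (e m))

∈-upTo : ∀ {A : Set} (e : ℕ → List A) {a l m} → a ∈ e l → l ℕ.< m → a ∈ upTo e m
∈-upTo e {l = l} a∈ l<m with upTo-prefix e (ℕ.≤⇒≤′ l<m)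
... | ys , eq = subst (_ ∈_) (sym eq) (∈-++⁺ˡ (∈-++⁺ʳ (upTo e l) a∈))

-- Enumeration in finite stages, with repetitions allowed. No pairing function on the naturals is
-- then required for products, and finite types fit in a single stage.
Countable : Set → Set
Countable A = Σ (ℕ → List A) λ e → ∀ a → ∃ λ m → a ∈ e m

image-countable : ∀ {A B : Set} (f : A → B) → (∀ b → ∃ λ a → f a ≡ b) → Countable A → Countable B
image-countable f f-surj (e , e-all) = map f ∘ e , λ b → let a , fa≡b = f-surj b ; m , a∈ = e-all a in
  m , subst (_∈ map f (e m)) fa≡b (∈-map⁺ f a∈)

Σ-countable : ∀ {A : Set} {B : A → Set} → Countable A → (∀ a → Countable (B a)) → Countable (Σ A B)
Σ-countable {A} {B} (e , e-all) cB = (λ m → concatMap (row m) (upTo e m)) , covers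
  where
  row : ℕ → A → List (Σ A B)
  row m a = map (a ,_) (upTo (proj₁ (cB a)) m)
  covers : ∀ p → ∃ λ m → p ∈ concatMap (row m) (upTo e m)
  covers (a , b) with e-all a | proj₂ (cB a) b
  -- The successor is there because `upTo` stops before its bound; both stages `i` and `j` are then
  -- included.
  ... | i , a∈ | j , b∈ = suc (i ℕ.⊔ j) , ∈-concatMap⁺ (row (suc (i ℕ.⊔ j)))
    (lose (∈-upTo e a∈ (ℕ.s≤s (ℕ.m≤m⊔n i j)))
          (∈-map⁺ (a ,_) (∈-upTo (proj₁ (cB a)) b∈ (ℕ.s≤s (ℕ.m≤n⊔m i j)))))

×-countable : ∀ {A B : Set} → Countable A → Countable B → Countable (A × B)
×-countable cA cB = Σ-countable cA (λ _ → cB)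

ℕ-countable : Countable ℕ
ℕ-countable = (λ m → m ∷ []) , λ m → m , here refl

Fin-countable : ∀ m → Countable (Fin m)
Fin-countable m = (λ _ → allFin m) , λ i → 0 , ∈-allFin i

ℤ-countable : Countable ℤ.ℤ
ℤ-countable = (λ m → ℤ.+ m ∷ ℤ.-[1+ m ] ∷ []) ,
  λ { (ℤ.+ m) → m , here refl ; ℤ.-[1+ m ] → m , there (here refl) }

-- The second component is the denominator minus one, as stored by `mkℚ`. Unreduced fractions merely
-- produce repetitions.
ℚ-countable : Countable ℚ
ℚ-countable = image-countable (λ (i , d) → i / suc d) (λ { p@(mkℚ i d _) → (i , d) , ↥p/↧p≡p p })
  (×-countable ℤ-countable ℕ-countable)

Vec-countable : ∀ {A} → Countable A → ∀ m → Countable (Vec A m)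
Vec-countable cA zero    = (λ _ → [] ∷ []) , λ { [] → 0 , here refl }
Vec-countable cA (suc m) = image-countable (uncurry _∷_) (λ { (a ∷ v) → (a , v) , refl })
  (×-countable cA (Vec-countable cA m))

List-countable : ∀ {A} → Countable A → Countable (List A)
List-countable cA = image-countable (toList ∘ proj₂) (λ xs → (_ , fromList xs) , toList∘fromList xs)
  (Σ-countable ℕ-countable (Vec-countable cA))

isDist? : ∀ {m} (μ : Dist m) → Dec (IsDist μ)
isDist? μ = all? (λ i → 0ℚ ≤? lookup μ i) ×-dec (sumF (lookup μ) ℚ.≟ 1ℚ)

trivial : ∀ {k} → LPTS k
trivial = record { n = 1 ; start = zero ; trans = [] ; wf = λ () }

module _ {k : ℕ} where

  Raw : Set
  Raw = Σ ℕ λ m → Fin m × List (Trans k m)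

  Raw-countable : Countable Raw
  Raw-countable = Σ-countable ℕ-countable λ m → ×-countable (Fin-countable m)
    (List-countable (×-countable (Fin-countable m) (×-countable (Fin-countable k) (Vec-countable ℚ-countable m))))

  -- LPTSs are enumerated only up to the well-formedness proof, on which ⪯ does not depend.
  reprove : (U : LPTS k) → All (IsDist ∘ proj₂ ∘ proj₂) (trans U) → LPTS k
  reprove U d = record { n = n U ; start = start U ; trans = trans U ; wf = All.lookup d }

  -- The decision is an argument so that completeness can be shown by cases on it. Raw data with an
  -- invalid distribution are mapped to a harmless default.
  assemble : (r : Raw) → Dec (All (IsDist ∘ proj₂ ∘ proj₂) (proj₂ (proj₂ r))) → LPTS k
  assemble (m , s , ts) (yes d) = record { n = m ; start = s ; trans = ts ; wf = All.lookup d }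
  assemble (m , s , ts) (no _)  = trivial

  assemble-complete : ∀ U d? → ∃ λ d → assemble (n U , start U , trans U) d? ≡ reprove U d
  assemble-complete U (yes d) = d , refl
  assemble-complete U (no ¬d) = contradiction (All.tabulate (wf U)) ¬d

  fromRaw : Raw → LPTS k
  fromRaw r = assemble r (All.all? (isDist? ∘ proj₂ ∘ proj₂) (proj₂ (proj₂ r)))

  candidates : ℕ → List (LPTS k)
  candidates = upTo (map fromRaw ∘ proj₁ Raw-countable)

  candidates-prefix : ∀ {l m} → l ℕ.≤ m → ∃ λ ys → candidates m ≡ candidates l ++ ys
  candidates-prefix l≤m = upTo-prefix (map fromRaw ∘ proj₁ Raw-countable) (ℕ.≤⇒≤′ l≤m)

  candidates-complete : ∀ U → ∃ λ m → ∃ λ d → reprove U d ∈ candidates m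
  candidates-complete U =
    let r = n U , start U , trans U
        m , r∈ = proj₂ Raw-countable r
        d , eq = assemble-complete U (All.all? (isDist? ∘ proj₂ ∘ proj₂) (trans U))
    in suc m , d , subst (_∈ candidates (suc m)) eq
         (∈-upTo (map fromRaw ∘ proj₁ Raw-countable) {l = m} (∈-map⁺ fromRaw r∈) ℕ.≤-refl)

-- The learner

-- The condition that `Consistent` imposes on a single counterexample, where it is local and cannot
-- be named.
Agrees : ∀ {k} → LPTS k → Tree k × Polarity → Set₁
Agrees H ((C , _) , positive) = C ⪯ H
Agrees H ((C , _) , negative) = ¬ (C ⪯ H)

agrees? : ∀ {k} (H : LPTS k) c → Dec (Agrees H c)
agrees? H ((C , _) , positive) = ⪯-dec C H
agrees? H ((C , _) , negative) = ¬? (⪯-dec C H)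

agrees⇒consistent : ∀ {k} {H : LPTS k} {cs} → All (Agrees H) cs → Consistent H cs
agrees⇒consistent = All.map (λ { {_ , positive} C⪯H → C⪯H ; {_ , negative} C⋠H → C⋠H })

agrees-reprove : ∀ {k} (U : LPTS k) d c → Agrees U c → Agrees (reprove U d) c
agrees-reprove U d (_ , positive) C⪯U = C⪯U
agrees-reprove U d (_ , negative) C⋠U = C⋠U

consistent? : ∀ {k} (H : LPTS k) cs → Dec (All (Agrees H) cs)
consistent? H = All.all? (agrees? H)

positiveJoin : ∀ {k} → Counterexamples k → LPTS k
-- An LPTS without transitions is simulated by every LPTS, so it is the empty join.
positiveJoin []                          = trivial
positiveJoin (((C , _) , positive) ∷ cs) = join C (positiveJoin cs)
positiveJoin ((_ , negative) ∷ cs)       = positiveJoin cs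

positiveJoin-upper : ∀ {k} (C : Tree k) {cs} → (C , positive) ∈ cs → proj₁ C ⪯ positiveJoin cs
positiveJoin-upper (C , _) {_ ∷ cs} (here refl) = ⪯-joinˡ C (positiveJoin cs)
positiveJoin-upper C {((D , _) , positive) ∷ cs} (there C∈) =
  ⪯-trans (proj₁ C) (positiveJoin cs) (join D (positiveJoin cs)) (positiveJoin-upper C C∈) (⪯-joinʳ D (positiveJoin cs))
positiveJoin-upper C {(_ , negative) ∷ cs} (there C∈) = positiveJoin-upper C C∈

positiveJoin-least : ∀ {k} (U : LPTS k) {cs} → All (Agrees U) cs → positiveJoin cs ⪯ U
positiveJoin-least U {cs = []} [] = (λ _ _ → ⊤) , (λ _ _ _ _ _ ()) , tt
positiveJoin-least U {cs = ((C , _) , positive) ∷ cs} (C⪯U ∷ ok) =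
  join-lub C (positiveJoin cs) U C⪯U (positiveJoin-least U ok)
positiveJoin-least U {cs = (_ , negative) ∷ cs} (_ ∷ ok) = positiveJoin-least U ok

positiveJoin-agrees : ∀ {k} {U : LPTS k} {cs} → All (Agrees U) cs → All (Agrees (positiveJoin cs)) cs
positiveJoin-agrees {U = U} {cs} ok = All.tabulate λ
  { {C , positive} C∈       → positiveJoin-upper C C∈
  ; {C , negative} C∈ C⪯J → All.lookup ok C∈ (⪯-trans (proj₁ C) (positiveJoin cs) U C⪯J (positiveJoin-least U ok)) }

firstConsistent : ∀ {k} → List (LPTS k) → Counterexamples k → LPTS k
firstConsistent []       cs = positiveJoin cs
firstConsistent (H ∷ Hs) cs with consistent? H cs
... | yes _ = H
... | no  _ = firstConsistent Hs cs

firstConsistent-agrees : ∀ {k} {U : LPTS k} Hs {cs} → All (Agrees U) cs → All (Agrees (firstConsistent Hs cs)) cs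
firstConsistent-agrees []            ok = positiveJoin-agrees ok
firstConsistent-agrees (H ∷ Hs) {cs} ok with consistent? H cs
... | yes H-ok = H-ok
... | no  _    = firstConsistent-agrees Hs ok

Refuted : ∀ {k} → Counterexamples k → LPTS k → Set₁
Refuted cs H = ¬ All (Agrees H) cs

firstConsistent-skip : ∀ {k} {Hs : List (LPTS k)} {Hs′ cs} → All (Refuted cs) Hs →
                       firstConsistent (Hs ++ Hs′) cs ≡ firstConsistent Hs′ cs
firstConsistent-skip [] = refl
firstConsistent-skip {Hs = H ∷ Hs} {cs = cs} (H-bad ∷ bad) with consistent? H cs
... | yes H-ok = contradiction H-ok H-bad
... | no  _    = firstConsistent-skip bad

firstConsistent-head : ∀ {k} {H : LPTS k} {Hs cs} → All (Agrees H) cs → firstConsistent (H ∷ Hs) cs ≡ H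
firstConsistent-head {H = H} {cs = cs} H-ok with consistent? H cs
... | yes _     = refl
... | no  H-bad = contradiction H-ok H-bad

-- The interaction with the teacher and its termination

module Enumeration {k : ℕ} (candidates : ℕ → List (LPTS k))
  (candidates-prefix : ∀ {l m} → l ℕ.≤ m → ∃ λ Hs → candidates m ≡ candidates l ++ Hs) where

  -- Every unfinished round contributes exactly one counterexample, so `length cs` is the number of
  -- rounds played. The list of candidates searched thus grows with the rounds.
  learner : Learner k
  learner cs = firstConsistent (candidates (length cs)) cs

  module _ (U : LPTS k) (T : Teacher k) (friendly : FriendlyTeacher U learner T) where

    private
      history : ℕ → Transcript k
      history = transcript learner T
      cexs : ℕ → Counterexamples k
      cexs m = cexsOf (history m)
      hyp : ℕ → LPTS k
      hyp m = learner (cexs m)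
      answer : ℕ → Response k
      answer m = T (history m) (hyp m)

    Done : ℕ → Set₁
    Done m = Σ (LPTS k) λ H → ∃ λ rest → history m ≡ (H , equivalent) ∷ rest × H ≃ U

    -- The invariant of an unfinished interaction. The equation on the length identifies the list of
    -- candidates searched in round `m` as `candidates m`.
    Running : ℕ → Set₁
    Running m = finished (history m) ≡ false × length (cexs m) ≡ m × All (Agrees U) (cexs m)

    Refutes : ℕ → Tree k × Polarity → Set₁
    Refutes m c = cexs (suc m) ≡ c ∷ cexs m × ¬ Agrees (hyp m) c

    history-suc : ∀ m → finished (history m) ≡ false → history (suc m) ≡ (hyp m , answer m) ∷ history m
    history-suc m eq = cong (λ b → if b then history m else (hyp m , answer m) ∷ history m) eq

    done-suc : ∀ m → Done m → Done (suc m)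
    done-suc m (H , rest , eq , H≃U) = H , rest ,
      ≡-trans (cong (λ b → if b then history m else (hyp m , answer m) ∷ history m) (cong finished eq)) eq , H≃U

    -- A counterexample of either polarity separates the two LPTSs: `U` agrees with it, which
    -- preserves the invariant, and the hypothesis does not.
    step : ∀ m → Running m → Done (suc m) ⊎ (Running (suc m) × ∃ (Refutes m))
    step m (unfinished , len , ok) = go (answer m) (history-suc m unfinished) (friendly m unfinished)
      where
      -- The answer is generalised to `r`, with the equation for the transcript kept, so that it can
      -- be analysed by cases.
      go : ∀ r → history (suc m) ≡ (hyp m , r) ∷ history m → FriendlyAnswer U (hyp m) r →
           Done (suc m) ⊎ (Running (suc m) × ∃ (Refutes m))
      go equivalent eq H≃U = inj₁ (hyp m , history m , eq , H≃U)
      go (counterexample C positive) eq (C⪯U , C⋠H , _) = inj₂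
        ((cong finished eq , ≡-trans (cong (length ∘ cexsOf) eq) (cong suc len) ,
          subst (All (Agrees U)) (sym (cong cexsOf eq)) (C⪯U ∷ ok)) , (C , positive) , cong cexsOf eq , C⋠H)
      go (counterexample C negative) eq (C⪯H , C⋠U , _) = inj₂
        ((cong finished eq , ≡-trans (cong (length ∘ cexsOf) eq) (cong suc len) ,
          subst (All (Agrees U)) (sym (cong cexsOf eq)) (C⋠U ∷ ok)) , (C , negative) , cong cexsOf eq , λ C⋠H → C⋠H C⪯H)

    status : ∀ m → Running m ⊎ Done m
    status zero    = inj₁ (refl , refl , [])
    status (suc m) = [ (λ running → [ inj₂ , inj₁ ∘ proj₁ ]′ (step m running)) , inj₂ ∘ done-suc m ]′ (status m)

    consistent : ConsistentLearner learner T
    consistent m unfinished = go (status m)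
      where
      go : Running m ⊎ Done m → Consistent (hyp m) (cexs m)
      go (inj₁ (_ , _ , ok)) = agrees⇒consistent (firstConsistent-agrees (candidates (length (cexs m))) ok)
      go (inj₂ (_ , _ , eq , _)) with () ← ≡-trans (sym unfinished) (cong finished eq)

    -- Counterexamples are never withdrawn, so a refutation is permanent.
    refuted-suc : ∀ m {c H} → Refutes m c → Refuted (cexs m) H → Refuted (cexs (suc m)) H
    refuted-suc m {H = H} (eq , _) bad ok = bad (All.tail (subst (All (Agrees H)) eq ok))

    -- Induction on `Hs′`, the candidates among the first `N` stages not yet discarded. Its head `H`
    -- is either refuted already, and is discarded without playing a round, or it is the current
    -- hypothesis, and the next round ends the interaction or refutes it. Since `U′`, the enumerated
    -- stand-in for `U`, is never refuted, it stays in `Hs′`, which therefore cannot run empty.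
    search : ∀ N {U′} m Hs Hs′ → (∀ c → Agrees U c → Agrees U′ c) → U′ ∈ Hs′ →
             candidates N ≡ Hs ++ Hs′ → N ℕ.≤ m → Running m → All (Refuted (cexs m)) Hs → ∃ Done
    search N {U′} m Hs (H ∷ Hs′) U⇒U′ U′∈ split N≤m running@(_ , len , ok) bad = go (consistent? H (cexs m))
      where
      split′ : candidates N ≡ (Hs ∷ʳ H) ++ Hs′
      split′ = ≡-trans split (sym (∷ʳ-++ Hs H Hs′))
      later : ∀ m′ → Running m′ → Refuted (cexs m′) H → U′ ∈ H ∷ Hs′ → U′ ∈ Hs′
      later m′ (_ , _ , ok′) H-bad (here refl)  = contradiction (All.map (λ {c} → U⇒U′ c) ok′) H-bad
      later m′ _             _     (there U′∈′) = U′∈′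
      go : Dec (All (Agrees H) (cexs m)) → ∃ Done
      go (no H-bad) = search N m (Hs ∷ʳ H) Hs′ U⇒U′ (later m running H-bad U′∈) split′ N≤m running (All.∷ʳ⁺ bad H-bad)
      go (yes H-ok) = [ suc m ,_ , continue ]′ (step m running)
        where
        -- The candidates added after stage `N`. They come behind `H` and cannot affect which
        -- candidate is the first consistent one.
        ys = proj₁ (candidates-prefix N≤m)
        hyp≡H : hyp m ≡ H
        hyp≡H = begin
          firstConsistent (candidates (length (cexs m))) (cexs m)  ≡⟨ cong (λ l → firstConsistent (candidates l) (cexs m)) len ⟩
          firstConsistent (candidates m) (cexs m)                  ≡⟨ cong (λ Ks → firstConsistent Ks (cexs m))
                                                                       (≡-trans (proj₂ (candidates-prefix N≤m))
                                                                       (≡-trans (cong (_++ ys) split) (++-assoc Hs (H ∷ Hs′) ys))) ⟩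
          firstConsistent (Hs ++ (H ∷ Hs′) ++ ys) (cexs m)         ≡⟨ firstConsistent-skip bad ⟩
          firstConsistent (H ∷ (Hs′ ++ ys)) (cexs m)               ≡⟨ firstConsistent-head H-ok ⟩
          H                                                        ∎
          where open ≡-Reasoning
        continue : Running (suc m) × ∃ (Refutes m) → ∃ Done
        continue (running′ , c , refutes@(eq , hyp-bad)) =
          search N (suc m) (Hs ∷ʳ H) Hs′ U⇒U′ (later (suc m) running′ H-bad U′∈) split′ (ℕ.m≤n⇒m≤1+n N≤m) running′
            (All.∷ʳ⁺ (All.map (refuted-suc m refutes) bad) H-bad)
          where
          H-bad : Refuted (cexs (suc m)) H
          H-bad ok′ = hyp-bad (subst (λ K → Agrees K c) (sym hyp≡H) (All.head (subst (All (Agrees H)) eq ok′)))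

    learns : ∀ N {U′} → (∀ c → Agrees U c → Agrees U′ c) → U′ ∈ candidates N → LearnsInFinitelyManyRounds U learner T
    learns N U⇒U′ U′∈ =
      -- The search starts in round `N`, from which on `U′` is among the candidates; the interaction
      -- may have ended before that.
      [ (λ running → search N N [] (candidates N) U⇒U′ U′∈ refl ℕ.≤-refl running []) , N ,_ ]′ (status N)

theorem5 : (k : ℕ) → Σ (Learner k) λ L →
    (U : LPTS k) (T : Teacher k) → FriendlyTeacher U L T →
    ConsistentLearner L T × LearnsInFinitelyManyRounds U L T
theorem5 k = learner , λ U T friendly →
  let N , d , U′∈ = candidates-complete U
  in consistent U T friendly , learns U T friendly N (agrees-reprove U d) U′∈
  where open Enumeration (candidates {k}) candidates-prefix
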